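{- The tree $T_B(\infty)$ can be represented by the infinite chain defined as follows: for each $i\ge 1$, the $i$-th node of this chain is the partition $(1,\dots,1)$ with $i-1$ ones (so the first node is the empty partition $()$); it is linked to the following node of the chain by an edge of $T_B(\infty)$ labeled with $i$, and it is the root of an $X_{i-1}$ subtree. That is, the node set of $T_B(\infty)$ is the disjoint union, over $i\ge 1$, of the node sets of the $X_{i-1}$ subtrees rooted at the chain nodes, and the edges of $T_B(\infty)$ are exactly the edges of these subtrees together with the edges of the chain.
   Context: A partition is a finite sequence of integers $a=(a_1,\dots,a_k)$ with $a_1\ge\dots\ge a_k>0$ (the empty partition $()$ is allowed); by convention $a_j=0$ for $j>k$. $a^{\downarrow_i}$ denotes the sequence obtained from $a$ by replacing $a_i$ by $a_i+1$. $T_B(\infty)$ is the edge-labeled rooted binary tree with root $()$ in which every node $a$ has a left son $a^{\downarrow_1}$ (edge labeled $1$), and in which a nonempty node $a$ has in addition a right son exactly when, with $p\ge 1$ denoting the number of parts of $a$ equal to $a_1$, one has $a_p-a_{p+1}=1$; the right son is then $a^{\downarrow_{p+1}}$ (edge labeled $p+1$). Its nodes are the partitions generated from the root in this way. For $k\ge 1$, an $X_k$ subtree is a subtree of $T_B(\infty)$ rooted at a node $a=(i,\dots,i,a_{k+1},\dots)$ whose first $k$ parts equal $i$ and with $a_{k+1}\le i-1$, and which is: the whole subtree of $T_B(\infty)$ rooted at $a$ if $a$ has only one son; and otherwise $a$ together with its left subtree (the whole subtree rooted at its left son, and the edge to it). An $X_0$ subtree is a single node. -}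

module Defs where

open import Data.Nat using (ℕ; zero; suc; _∸_; _≤_; _≥_; _<_; _>_; z≤n; s≤s)
open import Data.Nat.Properties using (_≟_; ≤-refl; m≤n⇒m≤1+n; m∸n≢0⇒n<m; 1+n≢0)
open import Data.List using (List; []; _∷_; filter; length; replicate)
open import Data.List.Properties using (≡-dec)
open import Data.List.Relation.Unary.All using (All; []; _∷_)
import Data.List.Relation.Unary.All.Properties as All
open import Data.List.Relation.Unary.Linked using (Linked; []; [-]; _∷_)
open import Data.Product using (∃-syntax; _×_; _,_)
open import Data.Empty using (⊥)
open import Data.Bool using (if_then_else_)
open import Relation.Nullary using (Dec; does; ¬?; _×-dec_)
open import Relation.Binary.PropositionalEquality using (_≡_; _≢_; refl; sym; trans)
open import Relation.Binary.Construct.Closure.ReflexiveTransitive using (Star)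

-- The proofs are irrelevant, so partitions with the same parts are equal.
record Partition : Set where
  constructor partition
  field
    parts       : List ℕ
    .decreasing : Linked _≥_ parts
    .positive   : All (_> 0) parts
open Partition public

-- Positions are counted from 1, and parts past the end are 0.
-- Position 0 does not exist; its value 0 is junk.
part : List ℕ → ℕ → ℕ
part []       _             = 0
part (x ∷ xs) zero          = 0
part (x ∷ xs) (suc zero)    = x
part (x ∷ xs) (suc (suc i)) = part xs (suc i)

-- xs ↓ i adds 1 to the i-th part (again counted from 1), padding with zeros
-- if i is past the end.
infixl 6 _↓_
_↓_ : List ℕ → ℕ → List ℕ
xs       ↓ zero          = xs
[]       ↓ suc zero      = 1 ∷ []
[]       ↓ suc (suc i)   = 0 ∷ ([] ↓ suc i)
(x ∷ xs) ↓ suc zero      = suc x ∷ xs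
(x ∷ xs) ↓ suc (suc i)   = x ∷ (xs ↓ suc i)

↓1-decreasing : ∀ {xs} → Linked _≥_ xs → Linked _≥_ (xs ↓ 1)
↓1-decreasing []       = [-]
↓1-decreasing [-]      = [-]
↓1-decreasing (p ∷ ps) = m≤n⇒m≤1+n p ∷ ps

↓1-positive : ∀ {xs} → All (_> 0) xs → All (_> 0) (xs ↓ 1)
↓1-positive []       = s≤s z≤n ∷ []
↓1-positive (p ∷ ps) = s≤s z≤n ∷ ps

↓-decreasing : ∀ {xs} i → part xs (suc i) < part xs i →
               Linked _≥_ xs → Linked _≥_ (xs ↓ suc i)
↓-decreasing zero          () []
↓-decreasing (suc i)       () []
↓-decreasing zero          () [-]
↓-decreasing (suc zero)    lt [-]      = lt ∷ [-]
↓-decreasing (suc (suc i)) () [-]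
↓-decreasing zero          () (p ∷ ps)
↓-decreasing (suc zero)    lt (p ∷ ps) = lt ∷ ↓1-decreasing ps
↓-decreasing (suc (suc i)) lt (p ∷ ps) = p ∷ ↓-decreasing (suc i) lt ps

↓-positive : ∀ {xs} i → part xs (suc i) < part xs i →
             All (_> 0) xs → All (_> 0) (xs ↓ suc i)
↓-positive i             () []
↓-positive zero          () (p ∷ ps)
↓-positive (suc zero)    lt (p ∷ ps) = p ∷ ↓1-positive ps
↓-positive (suc (suc i)) lt (p ∷ ps) = p ∷ ↓-positive (suc i) lt ps

root : Partition
root = partition [] [] []

-- The number p of parts equal to the first part.
plateau : Partition → ℕ
plateau a = length (filter (_≟ part (parts a) 1) (parts a))

HasRightSon : Partition → Set
HasRightSon a =
  parts a ≢ [] ×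
  part (parts a) (plateau a) ∸ part (parts a) (suc (plateau a)) ≡ 1

hasRightSon? : ∀ a → Dec (HasRightSon a)
hasRightSon? a = ¬? (≡-dec _≟_ (parts a) []) ×-dec (_ ≟ 1)

drop-at-plateau : ∀ a → HasRightSon a →
  part (parts a) (suc (plateau a)) < part (parts a) (plateau a)
drop-at-plateau a (_ , eq) =
  m∸n≢0⇒n<m λ eq₀ → 1+n≢0 (trans (sym eq) eq₀)

leftSon : Partition → Partition
leftSon (partition xs dec pos) =
  partition (xs ↓ 1) (↓1-decreasing dec) (↓1-positive pos)

rightSon : ∀ a → HasRightSon a → Partition
rightSon a@(partition xs dec pos) r =
  partition (xs ↓ suc (plateau a))
    (↓-decreasing (plateau a) (drop-at-plateau a r) dec)
    (↓-positive   (plateau a) (drop-at-plateau a r) pos)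

data _—[_]→_ : Partition → ℕ → Partition → Set where
  left  : ∀ {a} → a —[ 1 ]→ leftSon a
  right : ∀ {a} (r : HasRightSon a) → a —[ suc (plateau a) ]→ rightSon a r

-- a ↠ b: b is a descendant of a, possibly a itself.
_↠_ : Partition → Partition → Set
_↠_ = Star λ a b → ∃[ l ] a —[ l ]→ b

-- A set of nodes together with a set of labeled edges.
record Subgraph : Set₁ where
  field
    Node : Partition → Set
    Edge : Partition → ℕ → Partition → Set
open Subgraph public

below : Partition → Subgraph
below a = record
  { Node = λ b → a ↠ b
  ; Edge = λ b l c → a ↠ b × b —[ l ]→ c
  }

T-B∞ : Subgraph
T-B∞ = below root

single : Partition → Subgraph
single a = record
  { Node = λ b → b ≡ a
  ; Edge = λ _ _ _ → ⊥
  }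

data WithLeftNode (a : Partition) : Partition → Set where
  here  : WithLeftNode a a
  there : ∀ {b} → Node (below (leftSon a)) b → WithLeftNode a b

data WithLeftEdge (a : Partition) : Partition → ℕ → Partition → Set where
  here  : WithLeftEdge a a 1 (leftSon a)
  there : ∀ {b l c} → Edge (below (leftSon a)) b l c → WithLeftEdge a b l c

withLeft : Partition → Subgraph
withLeft a = record { Node = WithLeftNode a ; Edge = WithLeftEdge a }

-- The nodes at which an X k subtree may be rooted: for k ≥ 1, the first k
-- parts equal some i and the next part is at most i - 1.
IsXRoot : ℕ → Partition → Set
IsXRoot zero      a = Node T-B∞ a
IsXRoot k@(suc _) a = Node T-B∞ a × ∃[ i ]
  ((∀ j → 1 ≤ j → j ≤ k → part (parts a) j ≡ i) × part (parts a) (suc k) < i)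

-- The X k subtree rooted at a, meaningful only when IsXRoot k a. Since every
-- node has a left son, a has only one son exactly when it has no right son.
X : ℕ → Partition → Subgraph
X zero    a = single a
X (suc _) a = if does (hasRightSon? a) then withLeft a else below a

ones : ℕ → Partition
ones k = partition (replicate k 1) (decr k) (All.replicate⁺ k ≤-refl)
  where
  decr : ∀ k → Linked _≥_ (replicate k 1)
  decr zero          = []
  decr (suc zero)    = [-]
  decr (suc (suc k)) = ≤-refl ∷ decr (suc k)

-- The i-th node of the chain, for i ≥ 1.
chain : ℕ → Partition
chain i = ones (i ∸ 1)

data ChainEdge : Partition → ℕ → Partition → Set where
  link : ∀ {i} → 1 ≤ i → ChainEdge (chain i) i (chain (suc i))

-- The subtree hanging from the i-th node of the chain, for i ≥ 1.
hanging : ℕ → Subgraph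
hanging i = X (i ∸ 1) (chain i)

{-# OPTIONS --safe #-}
-- A node off the chain descends from the left son of some (1,…,1) with k ≥ 1
-- ones. Below that left son the first part is at least 2, so there is no right
-- son at a node whose parts are all equal: the drop to 0 past its end is at
-- least 2. Hence the number of parts stays k, which makes the subtrees disjoint.
module Submission where

open import Data.Nat using (ℕ; zero; suc; _∸_; _≤_; _<_; z≤n; s≤s; s≤s⁻¹)
open import Data.Nat.Properties using (_≟_; ≤-refl; ≤-trans; ≤-reflexive; n≤1+n; ≤∧≢⇒<)
open import Data.List using ([]; _∷_; length; replicate)
open import Data.List.Properties using (length-filter; length-replicate; filter-all; filter-complete)
open import Data.List.Relation.Unary.All using (All; []; _∷_)
open import Data.List.Relation.Unary.All.Properties using (all-filter; replicate⁺)
open import Data.Product using (_×_; ∃-syntax; _,_; -,_)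
open import Data.Sum using (_⊎_; inj₁; inj₂)
open import Data.Bool using (if_then_else_)
open import Data.Empty using (⊥-elim)
open import Function.Bundles using (_⇔_; mk⇔)
open import Relation.Nullary.Decidable using (dec-true)
open import Relation.Binary.PropositionalEquality
  using (_≡_; _≢_; refl; sym; trans; cong; cong₂; subst; subst₂)
open import Relation.Binary.Construct.Closure.ReflexiveTransitive using (ε; _◅_; _◅◅_)
open import Defs

parts-injective : ∀ {a b} → parts a ≡ parts b → a ≡ b
parts-injective refl = refl

part-past-end : ∀ xs → part xs (suc (length xs)) ≡ 0
part-past-end []       = refl
part-past-end (x ∷ xs) = part-past-end xs

part-replicate : ∀ {n x} j → 1 ≤ j → j ≤ n → part (replicate n x) j ≡ x
part-replicate {suc n} (suc zero)    _ _       = refl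
part-replicate {suc n} (suc (suc j)) _ (s≤s p) = part-replicate (suc j) (s≤s z≤n) p

part-replicate-past-end : ∀ n {x} → part (replicate n x) (suc n) ≡ 0
part-replicate-past-end n {x} =
  subst (λ m → part (replicate n x) (suc m) ≡ 0) (length-replicate n)
        (part-past-end (replicate n x))

part-last : ∀ {x y} ys → All (_≡ x) (y ∷ ys) → part (y ∷ ys) (length (y ∷ ys)) ≡ x
part-last []       (eq ∷ _)  = eq
part-last (_ ∷ ys) (_ ∷ eqs) = part-last ys eqs

replicate-↓ : ∀ n → replicate n 1 ↓ suc n ≡ replicate (suc n) 1
replicate-↓ zero    = refl
replicate-↓ (suc n) = cong (1 ∷_) (replicate-↓ n)

length-↓ : ∀ xs i → i < length xs → length (xs ↓ suc i) ≡ length xs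
length-↓ (x ∷ xs) zero    _ = refl
length-↓ (x ∷ xs) (suc i) p = cong suc (length-↓ xs i (s≤s⁻¹ p))

part₁-↓ : ∀ xs i → part xs 1 ≤ part (xs ↓ suc i) 1
part₁-↓ []       i       = z≤n
part₁-↓ (x ∷ xs) zero    = n≤1+n x
part₁-↓ (x ∷ xs) (suc i) = ≤-refl

plateau-ones : ∀ k → plateau (ones k) ≡ k
plateau-ones zero    = refl
plateau-ones (suc k) =
  trans (cong length (filter-all (_≟ 1) (replicate⁺ (suc k) refl)))
        (length-replicate (suc k))

-- All `suc k` parts lie on the plateau, and the drop past the end of the list is from 1 to 0, hence
-- exactly 1.
ones-hasRightSon : ∀ k → HasRightSon (ones (suc k))
ones-hasRightSon k =
  (λ ()) ,
  subst (λ p → part 1s p ∸ part 1s (suc p) ≡ 1) (sym (plateau-ones (suc k)))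
    (cong₂ _∸_ (part-replicate (suc k) (s≤s z≤n) ≤-refl)
               (part-replicate-past-end (suc k)))
  where
  1s = replicate (suc k) 1

rightSon-ones : ∀ k (r : HasRightSon (ones k)) → rightSon (ones k) r ≡ ones (suc k)
rightSon-ones k r = parts-injective
  (trans (cong (λ p → replicate k 1 ↓ suc p) (plateau-ones k)) (replicate-↓ k))

-- The chain leaves the empty partition through its left son, the only son there, and every later
-- node through its right son.
ones-edge : ∀ k → ones k —[ suc k ]→ ones (suc k)
ones-edge zero    = left
ones-edge (suc k) =
  subst₂ (ones (suc k) —[_]→_) (cong suc (plateau-ones (suc k)))
         (rightSon-ones (suc k) r) (right r)
  where
  r = ones-hasRightSon k

root↠ones : ∀ k → root ↠ ones k
root↠ones zero    = ε
root↠ones (suc k) = root↠ones k ◅◅ (-, ones-edge k) ◅ ε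

root↠leftSon : ∀ {a} → root ↠ a → root ↠ leftSon a
root↠leftSon p = p ◅◅ (-, left) ◅ ε

-- The `if` in `X` is stuck on a decision that does not reduce for a variable `k`. This equation
-- resolves it once, and nodes and edges are then transported along it.
hanging-ones : ∀ k → hanging (suc (suc k)) ≡ withLeft (ones (suc k))
hanging-ones k = cong (if_then withLeft a else below a)
                      (dec-true (hasRightSon? a) (ones-hasRightSon k))
  where
  a = ones (suc k)

-- An invariant carried along edges: `first≥2` persists because no edge lowers the first part, and
-- it is what keeps the length fixed.
record Narrow (k : ℕ) (a : Partition) : Set where
  constructor narrow
  field
    first≥2  : 2 ≤ part (parts a) 1
    length≡k : length (parts a) ≡ k

-- With equality all parts would be `x`, and the drop past the end would be `x` itself, which is not
-- 1. Strictness puts position `suc (plateau a)` inside the list, so the right son enlarges an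
-- existing part instead of appending one.
rightSon⇒plateau<length : ∀ a → 2 ≤ part (parts a) 1 → HasRightSon a →
                          plateau a < length (parts a)
rightSon⇒plateau<length a@(partition (x ∷ xs) _ _) x≥2 (_ , drop) =
  ≤∧≢⇒< (length-filter (_≟ x) (x ∷ xs)) λ eq →
    contra x≥2 (trans (sym (drop≡x eq)) drop)
  where
  all≡x : plateau a ≡ length (x ∷ xs) → All (_≡ x) (x ∷ xs)
  -- A filtered list of full length is the list itself, so every part passes the filter.
  all≡x eq = subst (All (_≡ x)) (filter-complete (_≟ x) eq)
                   (all-filter (_≟ x) (x ∷ xs))

  drop≡x : plateau a ≡ length (x ∷ xs) →
           part (x ∷ xs) (plateau a) ∸ part (x ∷ xs) (suc (plateau a)) ≡ x
  drop≡x eq = cong₂ _∸_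
    (trans (cong (part (x ∷ xs)) eq) (part-last xs (all≡x eq)))
    (trans (cong (λ p → part (x ∷ xs) (suc p)) eq) (part-past-end (x ∷ xs)))

  contra : ∀ {n} → 2 ≤ n → n ≢ 1
  contra (s≤s ()) refl

narrow-step : ∀ {k a l b} → Narrow k a → a —[ l ]→ b → Narrow k b
narrow-step {a = partition (x ∷ xs) _ _} (narrow x≥2 len) left =
  narrow (≤-trans x≥2 (n≤1+n x)) len
narrow-step {a = a} (narrow x≥2 len) (right r) =
  narrow (≤-trans x≥2 (part₁-↓ (parts a) (plateau a)))
         (trans (length-↓ (parts a) (plateau a) (rightSon⇒plateau<length a x≥2 r)) len)

narrow-↠ : ∀ {k a b} → Narrow k a → a ↠ b → Narrow k b
narrow-↠ n ε             = n
narrow-↠ n ((_ , e) ◅ p) = narrow-↠ (narrow-step n e) p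

narrow-leftSon-ones : ∀ k → Narrow (suc k) (leftSon (ones (suc k)))
narrow-leftSon-ones k = narrow ≤-refl (cong suc (length-replicate k))

-- The index is recovered from the node alone, so a node of two hanging subtrees forces their
-- indices to agree.
hanging-length : ∀ i {a} → 1 ≤ i → Node (hanging i) a → suc (length (parts a)) ≡ i
hanging-length (suc zero)    _ refl = refl
hanging-length (suc (suc k)) {a} _ n
  with subst (λ G → Node G a) (hanging-ones k) n
... | here    = cong suc (length-replicate (suc k))
... | there p = cong suc (Narrow.length≡k (narrow-↠ (narrow-leftSon-ones k) p))

-- The decomposition in a form closed under edges, free of the `if` in `X`, so that it can be proved
-- by induction along a path from the root. Off-chain nodes start at `suc k` ones because the left
-- son of the empty partition is still on the chain.
data Located : Partition → Set where
  onChain  : ∀ k → Located (ones k)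
  offChain : ∀ k {a} → leftSon (ones (suc k)) ↠ a → Located a

located-step : ∀ {a l b} → Located a → a —[ l ]→ b → Located b
located-step (onChain zero)    left      = onChain 1
-- The only way to leave the chain.
located-step (onChain (suc k)) left      = offChain k ε
located-step (onChain k)       (right r) = subst Located (sym (rightSon-ones k r)) (onChain (suc k))
located-step (offChain k p)    e         = offChain k (p ◅◅ (-, e) ◅ ε)

located-↠ : ∀ {a b} → Located a → a ↠ b → Located b
located-↠ loc ε             = loc
located-↠ loc ((_ , e) ◅ p) = located-↠ (located-step loc e) p

located : ∀ {a} → root ↠ a → Located a
located = located-↠ (onChain 0)

InHangingNode : Partition → Set
InHangingNode a = ∃[ i ] (1 ≤ i × Node (hanging i) a)

InHangingEdge : Partition → ℕ → Partition → Set
InHangingEdge a l b = ∃[ i ] (1 ≤ i × Edge (hanging i) a l b)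

withLeftNode⇒hanging : ∀ k {a} → WithLeftNode (ones (suc k)) a → InHangingNode a
withLeftNode⇒hanging k {a} n =
  suc (suc k) , s≤s z≤n , subst (λ G → Node G a) (sym (hanging-ones k)) n

withLeftEdge⇒hanging : ∀ k {a l b} → WithLeftEdge (ones (suc k)) a l b → InHangingEdge a l b
withLeftEdge⇒hanging k {a} {l} {b} e =
  suc (suc k) , s≤s z≤n , subst (λ G → Edge G a l b) (sym (hanging-ones k)) e

located⇒hanging : ∀ {a} → Located a → InHangingNode a
located⇒hanging (onChain zero)    = 1 , ≤-refl , refl
located⇒hanging (onChain (suc k)) = withLeftNode⇒hanging k here
located⇒hanging (offChain k p)    = withLeftNode⇒hanging k (there p)

hanging⇒node : ∀ {a} → InHangingNode a → Node T-B∞ a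
hanging⇒node (suc zero , _ , refl) = ε
hanging⇒node {a} (suc (suc k) , _ , n)
  with subst (λ G → Node G a) (hanging-ones k) n
... | here    = root↠ones (suc k)
... | there p = root↠leftSon (root↠ones (suc k)) ◅◅ p

-- The position of the source decides: off the chain the edge stays in the same subtree; at a
-- nonempty chain node the left edge is the top edge of the hanging subtree and the right edge
-- continues the chain.
located⇒edge : ∀ {a l b} → Located a → a —[ l ]→ b → InHangingEdge a l b ⊎ ChainEdge a l b
located⇒edge (onChain zero)    left              = inj₂ (link {1} ≤-refl)
located⇒edge (onChain zero)    (right (≢[] , _)) = ⊥-elim (≢[] refl)
located⇒edge (onChain (suc k)) left              = inj₁ (withLeftEdge⇒hanging k here)
located⇒edge (onChain (suc k)) (right r)         =
  -- The label and target of `right` are phrased through `plateau` and match those of `link` only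
  -- propositionally.
  inj₂ (subst₂ (ChainEdge (ones (suc k)))
               (sym (cong suc (plateau-ones (suc k))))
               (sym (rightSon-ones (suc k) r))
               (link {suc (suc k)} (s≤s z≤n)))
located⇒edge (offChain k p)    e                 = inj₁ (withLeftEdge⇒hanging k (there (p , e)))

chain-edge : ∀ i → 1 ≤ i → Edge T-B∞ (chain i) i (chain (suc i))
chain-edge (suc k) _ = root↠ones k , ones-edge k

edge⇒tree : ∀ {a l b} → InHangingEdge a l b ⊎ ChainEdge a l b → Edge T-B∞ a l b
edge⇒tree (inj₂ (link {i} 1≤i)) = chain-edge i 1≤i
edge⇒tree (inj₁ (suc zero , _ , ()))
edge⇒tree {a} {l} {b} (inj₁ (suc (suc k) , _ , e))
  with subst (λ G → Edge G a l b) (hanging-ones k) e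
... | here           = root↠ones (suc k) , left
... | there (p , e′) = root↠leftSon (root↠ones (suc k)) ◅◅ p , e′

chain-isXRoot : ∀ i → 1 ≤ i → IsXRoot (i ∸ 1) (chain i)
chain-isXRoot (suc zero)    _ = ε
chain-isXRoot (suc (suc k)) _ =
  -- The common value of the first parts is 1, and the next part is 0.
  root↠ones (suc k) , 1 , part-replicate ,
  s≤s (≤-reflexive (part-replicate-past-end (suc k)))

theorem4 : (∀ i → 1 ≤ i → Edge T-B∞ (chain i) i (chain (suc i)))
    × (∀ i → 1 ≤ i → IsXRoot (i ∸ 1) (chain i))
    × (∀ a → Node T-B∞ a ⇔ (∃[ i ] (1 ≤ i × Node (hanging i) a)))
    × (∀ i j a → 1 ≤ i → 1 ≤ j → Node (hanging i) a → Node (hanging j) a → i ≡ j)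
    × (∀ a l b → Edge T-B∞ a l b ⇔ ((∃[ i ] (1 ≤ i × Edge (hanging i) a l b)) ⊎ ChainEdge a l b))
theorem4 =
  chain-edge ,
  chain-isXRoot ,
  (λ a → mk⇔ (λ p → located⇒hanging (located p)) hanging⇒node) ,
  (λ i j a 1≤i 1≤j m n → trans (sym (hanging-length i 1≤i m)) (hanging-length j 1≤j n)) ,
  (λ a l b → mk⇔ (λ (p , e) → located⇒edge (located p) e) edge⇒tree)
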